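{- Let $N$ be a comparator network, let $D$ be a decomposition of $N$, let $\mathbf{A}$ be wire weights for $N$, and let $\mathbf{U}=\mathcal{P}_D(\mathbf{A})$ be the wire weights obtained by the weight propagation function $\mathcal{P}_D$. Then for any input vector $\vec{x}$ it holds that $w_{N,\mathbf{A}}(\vec{x})=w_{N,\mathbf{U}}(\vec{x})$.
   Context: **Comparator networks.** A comparator is a triple $\langle i,j,l\rangle$ of wires $1\le i<j$ and a level $l\ge 1$. Two comparators are compatible if their wire sets $\{i,j\}$ are disjoint or their levels are distinct. A comparator network on $n\ge1$ wires and $d\ge1$ layers is a set $N$ of mutually compatible comparators with all wires in $\{1,\dots,n\}$ and all levels in $\{1,\dots,d\}$. Given a (real) input vector $\vec{x}=(x_1,\dots,x_n)$, the wire values $(x_{ij})$, $1\le i\le n$, $0\le j\le d$, are defined by $x_{i0}=x_i$ and, for $l\ge1$: for each comparator $\langle i,j,l\rangle\in N$, $x_{il}=\min\{x_{i(l-1)},x_{j(l-1)}\}$ and $x_{jl}=\max\{x_{i(l-1)},x_{j(l-1)}\}$; and $x_{il}=x_{i(l-1)}$ for wires $i$ not incident with any comparator at level $l$. **Weights.** Wire weights for $N$ are non-negative numbers $\mathbf{A}=(a_{ij})$, $1\le i\le n$, $0\le j\le d$. The weight function is $w_{N,\mathbf{A}}(\vec{x})=\sum_{i=1}^n\sum_{j=0}^d a_{ij}x_{ij}$, where $(x_{ij})$ are the wire values of $N$ on $\vec{x}$. **Decompositions.** A network is confined to a set $I$ of wires and an interval $E$ of levels if every comparator $\langle i,j,l\rangle$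 in it has $\{i,j\}\subseteq I$ and $l\in E$. A confined network is a tuple $\langle N',I,E\rangle$ where $N'$ is a network confined to $I$ and $E$ (with $\emptyset\ne I\subseteq\{1,\dots,n\}$ and $E$ a nonempty interval in $\{1,\dots,d\}$). Confined networks $\langle N_1,I_1,E_1\rangle$, $\langle N_2,I_2,E_2\rangle$ are compatible if $I_1\cap I_2=\emptyset$ or $E_1\cap E_2=\emptyset$. A decomposition of $N$ is a set $\{S_1,\dots,S_m\}$ of mutually compatible confined networks $S_i=\langle N_i,I_i,E_i\rangle$ with $\bigcup_i N_i=N$. **Weight propagation.** For a confined network $C=\langle N',I,E\rangle$, the function $\mathcal{P}_C$ maps wire weights $(a_{ij})$ to $(u_{ij})$ where, with $c=\min\{a_{ij}\mid i\in I,\ j=\min E-1\}$: $u_{ij}=a_{ij}-c$ if $i\in I$ and $j=\min E-1$; $u_{ij}=a_{ij}+c$ if $i\in I$ and $j=\max E$; and $u_{ij}=a_{ij}$ otherwise. For compatible confined networks $C=\langle N_1,I,E\rangle$ and $C'=\langle N_2,I',E'\rangle$ write $C\le C'$ if $\min E\le\max E'$. If the elements of $D$ are listed as $S_1\le S_2\le\cdots\le S_m$ (consecutive elements related), then $\mathcal{P}_D=\mathcal{P}_{S_m}\circ\cdots\circ\mathcal{P}_{S_1}$. The statement holds for any such listing. -}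

module Defs where

open import Algebra.Bundles using (CommutativeRing)
import Algebra.Construct.NaturalChoice.Max as Max
import Algebra.Construct.NaturalChoice.Min as Min
import Algebra.Properties.CommutativeMonoid.Sum as Sum
open import Data.Bool.Base using (if_then_else_)
open import Data.Fin.Base using (Fin; suc; inject₁; toℕ; _≤_; _<_)
open import Data.Fin.Properties using (_≟_)
open import Data.Fin.Subset using (Subset; Nonempty; Empty; ⁅_⁆; _∪_; _∩_; _⊆_; _∈_)
open import Data.Fin.Subset.Properties using (_∈?_)
open import Data.List.Base using (List; []; _∷_; allFin; filter; foldl; map)
import Data.List.Extrema as Extrema
open import Data.List.Membership.Propositional using () renaming (_∈_ to _∈ˡ_)
open import Data.List.Membership.Propositional.Properties using (∈-map⁺; ∈-filter⁺; ∈-allFin)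
open import Data.List.Relation.Binary.Permutation.Propositional using (_↭_)
import Data.List.Relation.Unary.All as All
import Data.List.Relation.Unary.All.Properties as All
open import Data.List.Relation.Unary.AllPairs using (AllPairs)
open import Data.List.Relation.Unary.Any using (Any)
open import Data.List.Relation.Unary.Linked using (Linked)
open import Data.Nat.Base using (ℕ; zero; suc)
import Data.Nat.Properties as ℕ
open import Data.Product.Base using (_×_; _,_)
open import Data.Sum.Base using (_⊎_)
open import Function.Bundles using (_⇔_)
open import Level using (Level; _⊔_) renaming (suc to lsuc)
open import Relation.Binary.Bundles using (TotalOrder)
open import Relation.Binary.PropositionalEquality.Core using (_≡_; _≢_)
open import Relation.Binary.Structures using (IsTotalOrder)
open import Relation.Nullary using (¬_; does; yes; no)

private
  variable
    n d : ℕ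

-- Wires 1, …, n are the elements of Fin n.  Levels 1, …, d are the elements
-- of Fin d, while the columns 0, …, d of wire values and weights are the
-- elements of Fin (suc d).  Level l reads column inject₁ l and writes column
-- suc l; numbering levels from 1, these are columns l - 1 and l.

record Comparator (n d : ℕ) : Set where
  field
    lo hi : Fin n
    level : Fin d
    lo<hi : lo < hi

  wires : Subset n
  wires = ⁅ lo ⁆ ∪ ⁅ hi ⁆

Compatible : Comparator n d → Comparator n d → Set
Compatible c c′ =
  Empty (Comparator.wires c ∩ Comparator.wires c′) ⊎
  Comparator.level c ≢ Comparator.level c′

-- A finite set of comparators is given by a list enumerating it.  No
-- comparator is compatible with itself, so AllPairs also excludes repetitions.
record Network (n d : ℕ) : Set where
  field
    comparators : List (Comparator n d)
    compatible  : AllPairs Compatible comparators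

_∈ᴺ_ : Comparator n d → Network n d → Set
c ∈ᴺ N = c ∈ˡ Network.comparators N

record Interval (d : ℕ) : Set where
  field
    first last : Fin d
    first≤last : first ≤ last

_∈ᴵ_ : Fin d → Interval d → Set
l ∈ᴵ E = Interval.first E ≤ l × l ≤ Interval.last E

ConfinedTo : Network n d → Subset n → Interval d → Set
ConfinedTo N I E =
  ∀ c → c ∈ᴺ N → Comparator.wires c ⊆ I × Comparator.level c ∈ᴵ E

record ConfinedNetwork (n d : ℕ) : Set where
  field
    network  : Network n d
    I        : Subset n
    nonempty : Nonempty I
    E        : Interval d
    confined : ConfinedTo network I E

  open Interval E public

CompatibleC : ConfinedNetwork n d → ConfinedNetwork n d → Set
CompatibleC C C′ =
  Empty (ConfinedNetwork.I C ∩ ConfinedNetwork.I C′) ⊎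
  (∀ l → ¬ (l ∈ᴵ ConfinedNetwork.E C × l ∈ᴵ ConfinedNetwork.E C′))

-- As I and E are nonempty, AllPairs again excludes repetitions.
record Decomposition (N : Network n d) : Set where
  field
    parts      : List (ConfinedNetwork n d)
    compatible : AllPairs CompatibleC parts
    union      : ∀ c → c ∈ᴺ N ⇔ Any (λ S → c ∈ᴺ ConfinedNetwork.network S) parts

-- This relation is not transitive.
_≤ᶜ_ : ConfinedNetwork n d → ConfinedNetwork n d → Set
C ≤ᶜ C′ = ConfinedNetwork.first C ≤ ConfinedNetwork.last C′

-- Linked only relates consecutive elements.
record Listing {N : Network n d} (D : Decomposition N) : Set where
  field
    list    : List (ConfinedNetwork n d)
    list↭D  : list ↭ Decomposition.parts D
    ordered : Linked _≤ᶜ_ list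

-- The numbers used as inputs and weights.  ℝ, with its usual (classically
-- total) order, is the intended instance.
record TotallyOrderedCommutativeRing (c ℓ₁ ℓ₂ : Level) : Set (lsuc (c ⊔ ℓ₁ ⊔ ℓ₂)) where
  field
    commutativeRing : CommutativeRing c ℓ₁

  open CommutativeRing commutativeRing public

  infix 4 _≼_
  field
    _≼_          : Carrier → Carrier → Set ℓ₂
    isTotalOrder : IsTotalOrder _≈_ _≼_
    +-monoˡ-≼    : ∀ z {x y} → x ≼ y → x + z ≼ y + z
    *-nonNeg     : ∀ {x y} → 0# ≼ x → 0# ≼ y → 0# ≼ x * y

  totalOrder : TotalOrder c ℓ₁ ℓ₂
  totalOrder = record { isTotalOrder = isTotalOrder }

module Weights {c ℓ₁ ℓ₂} (R : TotallyOrderedCommutativeRing c ℓ₁ ℓ₂) where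

  open TotallyOrderedCommutativeRing R
  open Min totalOrder using () renaming (_⊓_ to min₂)
  open Max totalOrder using () renaming (_⊔_ to max₂)
  open Extrema totalOrder using (min; min≤xs; v≤min⁺)
  open Sum +-commutativeMonoid using (sum-syntax)

  -- The effect of the comparators of a single layer.  Compatible comparators
  -- on one level share no wires, so at most one list entry is relevant to k.
  layer : List (Comparator n d) → (Fin n → Carrier) → Fin n → Carrier
  layer []       v k = v k
  layer (c ∷ cs) v k =
    if does (k ≟ lo) then min₂ (v lo) (v hi)
    else if does (k ≟ hi) then max₂ (v lo) (v hi)
    else layer cs v k
    where open Comparator c

  -- wireValue N x j i is x_{ij}.  The column j is a natural number to allow
  -- structural recursion; column suc l is written by the level with index l.
  wireValue : Network n d → (Fin n → Carrier) → ℕ → Fin n → Carrier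
  wireValue N x zero    = x
  wireValue N x (suc l) =
    layer (filter (λ c → toℕ (Comparator.level c) ℕ.≟ l) (Network.comparators N))
          (wireValue N x l)

  record WireWeights (n d : ℕ) : Set (c ⊔ ℓ₂) where
    field
      weight : Fin n → Fin (suc d) → Carrier
      nonNeg : ∀ i j → 0# ≼ weight i j

  open WireWeights

  weightFunction : Network n d → WireWeights n d → (Fin n → Carrier) → Carrier
  weightFunction {n} {d} N A x =
    ∑[ i < n ] ∑[ j < suc d ] (weight A i j * wireValue N x (toℕ j) i)

  -- The minimum of f over I.  The first argument of min is one of the values
  -- already in the list; it only serves to make the list nonempty.
  minOver : (I : Subset n) → Nonempty I → (Fin n → Carrier) → Carrier
  minOver {n} I (i₀ , _) f = min (f i₀) (map f (filter (_∈? I) (allFin n)))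

  minOver≼ : (I : Subset n) (ne : Nonempty I) (f : Fin n → Carrier) →
             ∀ {i} → i ∈ I → minOver I ne f ≼ f i
  minOver≼ {n} I (i₀ , _) f i∈I =
    All.lookup (min≤xs (f i₀) (map f (filter (_∈? I) (allFin n))))
               (∈-map⁺ f (∈-filter⁺ (_∈? I) (∈-allFin _) i∈I))

  minOver-nonNeg : (I : Subset n) (ne : Nonempty I) (f : Fin n → Carrier) →
                   (∀ i → 0# ≼ f i) → 0# ≼ minOver I ne f
  minOver-nonNeg {n} I (i₀ , _) f 0≼f =
    v≤min⁺ {xs = map f (filter (_∈? I) (allFin n))} (0≼f i₀) (All.map⁺ (All.tabulate λ {i} _ → 0≼f i))

  module _ (C : ConfinedNetwork n d) where
    open ConfinedNetwork C

    -- Columns min E - 1 and max E.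
    entry exit : Fin (suc d)
    entry = inject₁ first
    exit  = suc last

    minEntry : WireWeights n d → Carrier
    minEntry A = minOver I nonempty (λ i → weight A i entry)

    propagatedWeight : WireWeights n d → Fin n → Fin (suc d) → Carrier
    propagatedWeight A i j =
      if does (i ∈? I)
      then (if does (j ≟ entry) then weight A i j - minEntry A
            else if does (j ≟ exit) then weight A i j + minEntry A
            else weight A i j)
      else weight A i j

    propagatedWeight-nonNeg : ∀ A i j → 0# ≼ propagatedWeight A i j
    propagatedWeight-nonNeg A i j with i ∈? I
    ... | no _ = nonNeg A i j
    ... | yes i∈I with j ≟ entry
    ...   | yes _≡_.refl =
      O.≤-respˡ-≈ (-‿inverseʳ (minEntry A))
        (+-monoˡ-≼ (- minEntry A) (minOver≼ I nonempty (λ i → weight A i entry) i∈I))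
      where module O = TotalOrder totalOrder
    ...   | no _ with j ≟ exit
    ...     | no _  = nonNeg A i j
    ...     | yes _ =
      O.trans (minOver-nonNeg I nonempty _ (λ i → nonNeg A i entry))
        (O.≤-respˡ-≈ (+-identityˡ (minEntry A)) (+-monoˡ-≼ (minEntry A) (nonNeg A i j)))
      where module O = TotalOrder totalOrder

    propagate : WireWeights n d → WireWeights n d
    propagate A = record
      { weight = propagatedWeight A
      ; nonNeg = propagatedWeight-nonNeg A
      }

  -- The head of the listing is applied first.
  propagateAll : {N : Network n d} {D : Decomposition N} →
                 Listing D → WireWeights n d → WireWeights n d
  propagateAll L A = foldl (λ B S → propagate S B) A (Listing.list L)

{-# OPTIONS --safe #-}

-- A confined network ⟨N′, I, E⟩ of the decomposition contains every comparator
-- of N that meets I on a level of E, by compatibility with the other parts.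
-- Each layer in E thus maps I to itself and, since min a b + max a b = a + b,
-- preserves the sum of the values on I.  This sum is therefore the same in the
-- columns min E − 1 and max E, and moving a weight c from the former to the
-- latter on all of I does not change the weight function.
module Submission where

open import Defs
import Algebra.Construct.NaturalChoice.Max as Max
import Algebra.Construct.NaturalChoice.Min as Min
import Algebra.Properties.CommutativeSemigroup as CommutativeSemigroup
import Algebra.Properties.Group as Group
import Algebra.Properties.Semiring.Sum as Sum
open import Data.Bool.Base using (if_then_else_)
open import Data.Fin.Base using (Fin; zero; suc; toℕ)
open import Data.Fin.Properties
  using (_≟_; <⇒≢; toℕ-inject₁; toℕ-injective; ≤̄⇒inject₁<)
open import Data.Fin.Subset using (Subset; Empty; _∩_; _∈_; _∉_)
open import Data.Fin.Subset.Properties using (_∈?_; x∈⁅x⁆; x∈p∪q⁺; x∈p∩q⁺)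
open import Data.List.Base using (List; []; _∷_; foldl; filter)
open import Data.List.Membership.Propositional using (find) renaming (_∈_ to _∈ˡ_)
open import Data.List.Membership.Propositional.Properties using (∈-AllPairs₂; ∈-filter⁻)
open import Data.List.Relation.Binary.Permutation.Propositional.Properties using (∈-resp-↭)
open import Data.List.Relation.Unary.All using (All; []; _∷_)
import Data.List.Relation.Unary.All as All
import Data.List.Relation.Unary.All.Properties as All
open import Data.List.Relation.Unary.AllPairs using (AllPairs; []; _∷_)
import Data.List.Relation.Unary.AllPairs.Properties as AllPairs
open import Data.Nat.Base using (ℕ; zero; suc; NonZero; _≤_; _≤′_; ≤′-refl; ≤′-step)
import Data.Nat.Properties as ℕ
open import Data.Product.Base using (_×_; _,_)
open import Data.Sum.Base using (_⊎_; inj₁; inj₂)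
open import Function.Base using (_∘_)
open import Function.Bundles using (Equivalence)
open import Relation.Binary.PropositionalEquality.Core as ≡ using (_≡_; _≢_)
import Relation.Binary.Reasoning.Setoid as SetoidReasoning
open import Relation.Binary.Structures using (IsTotalOrder)
open import Relation.Nullary using (does; yes; no; contradiction)
open import Relation.Nullary.Decidable using (dec-true; dec-false)

private
  variable
    n d : ℕ

-- Comparators of the network relative to a part of the decomposition.

Disjoint : Comparator n d → Comparator n d → Set
Disjoint c c′ = Empty (Comparator.wires c ∩ Comparator.wires c′)

-- A comparator with exactly one wire in `I` could change the sum of the values on `I`; this
-- excludes it.
Respects : Subset n → Comparator n d → Set
Respects I c = (lo ∈ I × hi ∈ I) ⊎ (lo ∉ I × hi ∉ I)
  where open Comparator c

lo∈wires : (c : Comparator n d) → Comparator.lo c ∈ Comparator.wires c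
lo∈wires c = x∈p∪q⁺ (inj₁ (x∈⁅x⁆ _))

hi∈wires : (c : Comparator n d) → Comparator.hi c ∈ Comparator.wires c
hi∈wires c = x∈p∪q⁺ (inj₂ (x∈⁅x⁆ _))

-- The comparator lies in some part `S′`. If `S′` is `S`, both wires are in `I` by confinement.
-- Otherwise the two parts are compatible: as the level lies in both intervals, the wire sets must
-- be disjoint, and both wires miss `I`.
part-respects : {N : Network n d} (D : Decomposition N) →
                ∀ {S} → S ∈ˡ Decomposition.parts D →
                ∀ {c} → c ∈ᴺ N → Comparator.level c ∈ᴵ ConfinedNetwork.E S →
                Respects (ConfinedNetwork.I S) c
part-respects D {S} S∈D {c} c∈N l∈E
  with S′ , S′∈D , c∈S′ ← find (Equivalence.to (Decomposition.union D c) c∈N)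
  with wires⊆I′ , l∈E′ ← ConfinedNetwork.confined S′ c c∈S′
  -- `AllPairs` relates earlier to later entries only, so compatibility of distinct parts arrives in
  -- either order and each case occurs twice.
  with ∈-AllPairs₂ (Decomposition.compatible D) S∈D S′∈D
... | inj₁ ≡.refl = inj₁ (wires⊆I′ (lo∈wires c) , wires⊆I′ (hi∈wires c))
... | inj₂ (inj₁ (inj₁ I∩I′=∅)) =
  inj₂ ( (λ lo∈I → I∩I′=∅ (_ , x∈p∩q⁺ (lo∈I , wires⊆I′ (lo∈wires c))))
       , (λ hi∈I → I∩I′=∅ (_ , x∈p∩q⁺ (hi∈I , wires⊆I′ (hi∈wires c)))))
... | inj₂ (inj₁ (inj₂ E∩E′=∅)) = contradiction (l∈E , l∈E′) (E∩E′=∅ _)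
... | inj₂ (inj₂ (inj₁ I′∩I=∅)) =
  inj₂ ( (λ lo∈I → I′∩I=∅ (_ , x∈p∩q⁺ (wires⊆I′ (lo∈wires c) , lo∈I)))
       , (λ hi∈I → I′∩I=∅ (_ , x∈p∩q⁺ (wires⊆I′ (hi∈wires c) , hi∈I))))
... | inj₂ (inj₂ (inj₂ E′∩E=∅)) = contradiction (l∈E′ , l∈E) (E′∩E=∅ _)

compatible⇒disjoint : ∀ {l} {cs : List (Comparator n d)} →
                      All (λ c → toℕ (Comparator.level c) ≡ l) cs →
                      AllPairs Compatible cs → AllPairs Disjoint cs
compatible⇒disjoint []         []         = []
compatible⇒disjoint (eq ∷ eqs) (px ∷ pxs) =
  All.zipWith (λ { (_   , inj₁ disj) → disj
                 ; (eq′ , inj₂ l≢l′) →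
                     contradiction (toℕ-injective (≡.trans eq (≡.sym eq′))) l≢l′ })
              (eqs , px)
  ∷ compatible⇒disjoint eqs pxs

module _ {r ℓ₁ ℓ₂} (R : TotallyOrderedCommutativeRing r ℓ₁ ℓ₂) where

  open TotallyOrderedCommutativeRing R
  open Weights R
  open WireWeights
  open Min totalOrder using () renaming (_⊓_ to min₂)
  open Max totalOrder using (x≤y⇒x⊔y≈y; x≤y⇒y⊔x≈y) renaming (_⊔_ to max₂)
  open Sum semiring
  open CommutativeSemigroup +-commutativeSemigroup using (x∙yz≈y∙xz; x∙yz≈z∙yx; x∙yz≈xz∙y)
  open Group +-group using () renaming (∙-cancelʳ to +-cancelʳ; //-rightDividesˡ to x-y+y≈x)
  open SetoidReasoning setoid

  -- Minimum, maximum and finite sums.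

  min+max : ∀ a b → min₂ a b + max₂ a b ≈ a + b
  min+max a b with IsTotalOrder.total isTotalOrder a b
  ... | inj₁ a≼b = +-cong refl (x≤y⇒x⊔y≈y a≼b)
  ... | inj₂ b≼a = trans (+-cong refl (x≤y⇒y⊔x≈y b≼a)) (+-comm b a)

  sum-single : ∀ (k : Fin n) a → ∑[ i < n ] (if does (i ≟ k) then a else 0#) ≈ a
  sum-single {suc n} zero    a = trans (+-congˡ (sum-replicate-zero n)) (+-identityʳ a)
  sum-single {suc n} (suc k) a = trans (+-identityˡ _) (sum-single k a)

  -- Exchange argument: adding the values of `g` at `a` and `b` to `f` gives the same function as
  -- adding those of `f` to `g`. The added totals agree by hypothesis and cancel, so no index has to
  -- be removed from a sum.
  sum-replace₂ : ∀ (f g : Fin n → Carrier) {a b} → a ≢ b →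
                 (∀ k → k ≢ a → k ≢ b → f k ≈ g k) →
                 f a + f b ≈ g a + g b → sum f ≈ sum g
  sum-replace₂ {n} f g {a} {b} a≢b f≈g eq = +-cancelʳ _ _ _ (begin
    sum f + (f a + f b)                            ≈⟨ +-congˡ eq ⟩
    sum f + (g a + g b)                            ≈⟨ expand f g ⟨
    ∑[ k < n ] (f k + (δ a (g a) k + δ b (g b) k)) ≈⟨ sum-cong-≋ pointwise ⟩
    ∑[ k < n ] (g k + (δ a (f a) k + δ b (f b) k)) ≈⟨ expand g f ⟩
    sum g + (f a + f b)                            ∎)
    where
    δ : Fin n → Carrier → Fin n → Carrier
    δ k y i = if does (i ≟ k) then y else 0#

    expand : ∀ p q → ∑[ k < n ] (p k + (δ a (q a) k + δ b (q b) k)) ≈ sum p + (q a + q b)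
    expand p q =
      trans (∑-distrib-+ p _)
        (+-congˡ (trans (∑-distrib-+ (δ a (q a)) _) (+-cong (sum-single a _) (sum-single b _))))

    pointwise : ∀ k → f k + (δ a (g a) k + δ b (g b) k) ≈ g k + (δ a (f a) k + δ b (f b) k)
    pointwise k with k ≟ a | k ≟ b
    ... | yes ≡.refl | yes ≡.refl = contradiction ≡.refl a≢b
    ... | yes ≡.refl | no _       = x∙yz≈y∙xz (f k) (g k) 0#
    ... | no _       | yes ≡.refl = x∙yz≈z∙yx (f k) 0# (g k)
    ... | no k≢a     | no k≢b     = +-congʳ (f≈g k k≢a k≢b)

  -- Sums over a wire set and the action of one layer.

  restrict : Subset n → (Fin n → Carrier) → Fin n → Carrier
  restrict I f i = if does (i ∈? I) then f i else 0#

  -- Extension by zero keeps the index type `Fin n`, so `sum-replace₂` and the general laws of `sum`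
  -- apply.
  sumOver : Subset n → (Fin n → Carrier) → Carrier
  sumOver I f = sum (restrict I f)

  restrict-cong : ∀ (I : Subset n) f g k → f k ≈ g k → restrict I f k ≈ restrict I g k
  restrict-cong I f g k eq with k ∈? I
  ... | yes _ = eq
  ... | no  _ = refl

  restrict-∈ : ∀ {I : Subset n} {k} f → k ∈ I → restrict I f k ≈ f k
  restrict-∈ {I = I} {k} f k∈I rewrite dec-true (k ∈? I) k∈I = refl

  restrict-∉ : ∀ {I : Subset n} {k} f → k ∉ I → restrict I f k ≈ 0#
  restrict-∉ {I = I} {k} f k∉I rewrite dec-false (k ∈? I) k∉I = refl

  layer-idle : ∀ (cs : List (Comparator n d)) v {k} →
               All (λ c → k ∉ Comparator.wires c) cs → layer cs v k ≡ v k
  layer-idle []       v         []           = ≡.refl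
  layer-idle (c ∷ cs) v {k} (k∉c ∷ k∉cs)
    rewrite dec-false (k ≟ Comparator.lo c) (λ { ≡.refl → k∉c (lo∈wires c) })
          | dec-false (k ≟ Comparator.hi c) (λ { ≡.refl → k∉c (hi∈wires c) })
    = layer-idle cs v k∉cs

  module _ (c : Comparator n d) (cs : List (Comparator n d)) (v : Fin n → Carrier) where
    open Comparator c

    layer-lo : layer (c ∷ cs) v lo ≡ min₂ (v lo) (v hi)
    layer-lo rewrite dec-true (lo ≟ lo) ≡.refl = ≡.refl

    layer-hi : layer (c ∷ cs) v hi ≡ max₂ (v lo) (v hi)
    -- `layer` tests `lo` first, so `lo<hi` is needed to reach the second branch.
    layer-hi rewrite dec-false (hi ≟ lo) (<⇒≢ lo<hi ∘ ≡.sym)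
                   | dec-true (hi ≟ hi) ≡.refl = ≡.refl

    layer-skip : ∀ {k} → k ≢ lo → k ≢ hi → layer (c ∷ cs) v k ≡ layer cs v k
    layer-skip {k} k≢lo k≢hi rewrite dec-false (k ≟ lo) k≢lo
                                   | dec-false (k ≟ hi) k≢hi = ≡.refl

  -- Induction on the comparators: dropping `c` alters only the values at its two wires. Either both
  -- count, and their sum is preserved, or both are replaced by zero.
  sumOver-layer : ∀ (I : Subset n) (cs : List (Comparator n d)) v →
                  AllPairs Disjoint cs → All (Respects I) cs →
                  sumOver I (layer cs v) ≈ sumOver I v
  sumOver-layer I []       v _              _            = refl
  sumOver-layer I (c ∷ cs) v (c# ∷ cs#) (resp ∷ resps) =
    trans
      (sum-replace₂ (restrict I new) (restrict I old) (<⇒≢ lo<hi)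
        (λ k k≢lo k≢hi → restrict-cong I new old k (reflexive (layer-skip c cs v k≢lo k≢hi)))
        (exchange resp))
      (sumOver-layer I cs v cs# resps)
    where
    open Comparator c
    new = layer (c ∷ cs) v
    old = layer cs v

    -- The remaining comparators are disjoint from `c`, so they leave on its wires the very inputs
    -- from which `c` takes its minimum and maximum.
    idle : ∀ {k} → k ∈ wires → old k ≡ v k
    idle k∈c = layer-idle cs v (All.map (λ c#c′ k∈c′ → c#c′ (_ , x∈p∩q⁺ (k∈c , k∈c′))) c#)

    exchange : Respects I c →
               restrict I new lo + restrict I new hi ≈ restrict I old lo + restrict I old hi
    exchange (inj₁ (lo∈I , hi∈I)) = begin
      restrict I new lo + restrict I new hi       ≈⟨ +-cong (restrict-∈ new lo∈I) (restrict-∈ new hi∈I) ⟩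
      new lo + new hi                             ≡⟨ ≡.cong₂ _+_ (layer-lo c cs v) (layer-hi c cs v) ⟩
      min₂ (v lo) (v hi) + max₂ (v lo) (v hi)     ≈⟨ min+max (v lo) (v hi) ⟩
      v lo + v hi                                 ≡⟨ ≡.cong₂ _+_ (idle (lo∈wires c)) (idle (hi∈wires c)) ⟨
      old lo + old hi                             ≈⟨ +-cong (restrict-∈ old lo∈I) (restrict-∈ old hi∈I) ⟨
      restrict I old lo + restrict I old hi       ∎
    exchange (inj₂ (lo∉I , hi∉I)) =
      trans (+-cong (restrict-∉ new lo∉I) (restrict-∉ new hi∉I))
            (sym (+-cong (restrict-∉ old lo∉I) (restrict-∉ old hi∉I)))

  -- Invariance across an interval of levels.

  constant-on-interval : ∀ (s : ℕ → Carrier) {a b} → a ≤′ b →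
                         (∀ l → a ≤ l → l ≤ b → s (suc l) ≈ s l) → s (suc b) ≈ s a
  -- A single level already makes one step: levels `a` to `b` lead from column `a` to column
  -- `suc b`.
  constant-on-interval s {a} ≤′-refl step = step a ℕ.≤-refl ℕ.≤-refl
  constant-on-interval s (≤′-step {b} a≤b) step =
    trans (step (suc b) (ℕ.≤′⇒≤ (≤′-step a≤b)) ℕ.≤-refl)
          (constant-on-interval s a≤b (λ l a≤l l≤b → step l a≤l (ℕ.m≤n⇒m≤1+n l≤b)))

  module _ {N : Network n d} (D : Decomposition N)
           {S : ConfinedNetwork n d} (S∈D : S ∈ˡ Decomposition.parts D)
           (x : Fin n → Carrier) where
    open ConfinedNetwork S

    private
      column : Fin (suc d) → Fin n → Carrier
      column j = wireValue N x (toℕ j)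

    sumOver-step : ∀ l → toℕ first ≤ l → l ≤ toℕ last →
                   sumOver I (wireValue N x (suc l)) ≈ sumOver I (wireValue N x l)
    sumOver-step l first≤l l≤last =
      sumOver-layer I (filter level≟l comparators) (wireValue N x l)
        (compatible⇒disjoint (All.all-filter level≟l comparators)
                             (AllPairs.filter⁺ level≟l compatible))
        (All.tabulate λ c∈ → let c∈N , eq = ∈-filter⁻ level≟l c∈ in
          part-respects D S∈D c∈N
            ( ≡.subst (toℕ first ≤_) (≡.sym eq) first≤l
            , ≡.subst (_≤ toℕ last) (≡.sym eq) l≤last))
      where
      open Network N
      level≟l = λ (c : Comparator n d) → toℕ (Comparator.level c) ℕ.≟ l

    sumOver-exit≈entry : sumOver I (column (exit S)) ≈ sumOver I (column (entry S))
    -- The exit column computes to `suc (toℕ last)`, but the entry column becomes `toℕ first` only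
    -- after this rewrite.
    sumOver-exit≈entry rewrite toℕ-inject₁ first =
      constant-on-interval (λ j → sumOver I (wireValue N x j)) (ℕ.≤⇒≤′ first≤last) sumOver-step

    -- Distinctness lets the gain at the exit and the loss at the entry be treated as changes to two
    -- separate columns.
    entry≢exit : entry S ≢ exit S
    entry≢exit = <⇒≢ (≤̄⇒inject₁< first≤last)

    -- Effect of one propagation on the weight function.

    module _ (A : WireWeights n d) where
      private
        c = minEntry S A

        columnSum : WireWeights n d → Fin (suc d) → Carrier
        columnSum B j = ∑[ i < n ] (weight B i j * column j i)

      -- The loss is written as an addition on the left, matching the gain in `columnSum-exit`, so
      -- the two can be traded without subtraction.
      columnSum-entry : columnSum (propagate S A) (entry S) + c * sumOver I (column (entry S))
                        ≈ columnSum A (entry S)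
      columnSum-entry = begin
        ∑[ i < n ] (weight (propagate S A) i j * y i) + c * sum (restrict I y)
          ≈⟨ +-congˡ (*-distribˡ-sum c (restrict I y)) ⟩
        ∑[ i < n ] (weight (propagate S A) i j * y i) + ∑[ i < n ] (c * restrict I y i)
          ≈⟨ ∑-distrib-+ (λ i → weight (propagate S A) i j * y i) _ ⟨
        ∑[ i < n ] (weight (propagate S A) i j * y i + c * restrict I y i)
          ≈⟨ sum-cong-≋ pointwise ⟩
        columnSum A j ∎
        where
        j = entry S
        y = column j
        pointwise : ∀ i → weight (propagate S A) i j * y i + c * restrict I y i ≈ weight A i j * y i
        pointwise i with i ∈? I
        -- Off `I` the weight is unchanged and the correction is `c * 0#`.
        ... | no _ = trans (+-congˡ (zeroʳ c)) (+-identityʳ _)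
        ... | yes _ rewrite dec-true (j ≟ j) ≡.refl = begin
          (weight A i j - c) * y i + c * y i ≈⟨ distribʳ (y i) _ c ⟨
          (weight A i j - c + c) * y i       ≈⟨ *-congʳ (x-y+y≈x c (weight A i j)) ⟩
          weight A i j * y i                 ∎

      columnSum-exit : columnSum (propagate S A) (exit S)
                       ≈ columnSum A (exit S) + c * sumOver I (column (exit S))
      columnSum-exit = begin
        columnSum (propagate S A) j
          ≈⟨ sum-cong-≋ pointwise ⟩
        ∑[ i < n ] (weight A i j * y i + c * restrict I y i)
          ≈⟨ ∑-distrib-+ (λ i → weight A i j * y i) _ ⟩
        columnSum A j + ∑[ i < n ] (c * restrict I y i)
          ≈⟨ +-congˡ (*-distribˡ-sum c (restrict I y)) ⟨
        columnSum A j + c * sum (restrict I y) ∎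
        where
        j = exit S
        y = column j
        pointwise : ∀ i → weight (propagate S A) i j * y i ≈ weight A i j * y i + c * restrict I y i
        pointwise i with i ∈? I
        ... | no _ = sym (trans (+-congˡ (zeroʳ c)) (+-identityʳ _))
        ... | yes _ rewrite dec-false (j ≟ entry S) (entry≢exit ∘ ≡.sym)
                          | dec-true (j ≟ j) ≡.refl = distribʳ (y i) (weight A i j) c

      propagate-skip : ∀ i {j} → j ≢ entry S → j ≢ exit S → weight (propagate S A) i j ≡ weight A i j
      propagate-skip i {j} j≢entry j≢exit with i ∈? I
      ... | no _ = ≡.refl
      ... | yes _ rewrite dec-false (j ≟ entry S) j≢entry
                        | dec-false (j ≟ exit S) j≢exit = ≡.refl

      -- With columns as the outer summation index, propagation changes just two summands, and
      -- `sum-replace₂` reduces the claim to their total.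
      weightFunction-propagate : weightFunction N (propagate S A) x ≈ weightFunction N A x
      weightFunction-propagate = begin
        weightFunction N U x
          ≈⟨ ∑-comm (λ i j → weight U i j * column j i) ⟩
        ∑[ j < suc d ] columnSum U j
          ≈⟨ sum-replace₂ (columnSum U) (columnSum A) entry≢exit
               (λ j j≢entry j≢exit → sum-cong-≋ λ i →
                 *-congʳ (reflexive (propagate-skip i j≢entry j≢exit)))
               transfer ⟩
        ∑[ j < suc d ] columnSum A j
          ≈⟨ ∑-comm (λ i j → weight A i j * column j i) ⟨
        weightFunction N A x ∎
        where
        U = propagate S A
        transfer : columnSum U (entry S) + columnSum U (exit S)
                   ≈ columnSum A (entry S) + columnSum A (exit S)
        transfer = begin
          columnSum U (entry S) + columnSum U (exit S)
            ≈⟨ +-congˡ columnSum-exit ⟩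
          columnSum U (entry S) + (columnSum A (exit S) + c * sumOver I (column (exit S)))
            ≈⟨ +-congˡ (+-congˡ (*-congˡ sumOver-exit≈entry)) ⟩
          columnSum U (entry S) + (columnSum A (exit S) + c * sumOver I (column (entry S)))
            ≈⟨ x∙yz≈xz∙y _ _ _ ⟩
          columnSum U (entry S) + c * sumOver I (column (entry S)) + columnSum A (exit S)
            ≈⟨ +-congʳ columnSum-entry ⟩
          columnSum A (entry S) + columnSum A (exit S) ∎

  -- Each propagation preserves the weight function for arbitrary weights, so the induction keeps
  -- `A` general and passes the propagated weights on.
  weightFunction-foldl : {N : Network n d} (D : Decomposition N) (x : Fin n → Carrier) →
    ∀ {Ss} → All (_∈ˡ Decomposition.parts D) Ss → ∀ A →
    weightFunction N A x ≈ weightFunction N (foldl (λ B S → propagate S B) A Ss) x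
  weightFunction-foldl D x []           A = refl
  weightFunction-foldl D x (S∈D ∷ Ss∈D) A =
    trans (sym (weightFunction-propagate D S∈D x A))
          (weightFunction-foldl D x Ss∈D (propagate _ A))

theorem2 : ∀ {c ℓ₁ ℓ₂} (R : TotallyOrderedCommutativeRing c ℓ₁ ℓ₂) →
    let open TotallyOrderedCommutativeRing R
        open Weights R
    in
    (n d : ℕ) .{{_ : NonZero n}} .{{_ : NonZero d}} →
    (N : Network n d) (D : Decomposition N) (L : Listing D)
    (A : WireWeights n d) (x : Fin n → Carrier) →
    weightFunction N A x ≈ weightFunction N (propagateAll L A) x
theorem2 R n d N D L A x =
  -- A listing permutes the parts of `D`, so each of its entries is a part.
  weightFunction-foldl R D x (All.tabulate (∈-resp-↭ (Listing.list↭D L))) A
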